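{- Let $A$ be a finite alphabet, $u$ a word over $A$, $k\ge 0$ an integer, and $a_1,\ldots,a_k\in A$. Then $$\binom{u}{a_1\cdots a_k}_q=\sum_{\substack{u_0,u_1,\ldots,u_k\in A^*\\ u=u_0a_1u_1\cdots u_{k-1}a_k u_k}} q^{\sum_{i=1}^k i|u_i|},$$ where the sum ranges over all tuples $(u_0,\ldots,u_k)$ of words with $u=u_0a_1u_1\cdots u_{k-1}a_ku_k$.
   Context: $A^*$ is the free monoid of finite words over $A$ (with concatenation and empty word $\varepsilon$), and $|w|$ is the length of a word $w$. The $q$-binomial coefficient $\binom{u}{v}_q\in\mathbb{N}[q]$ of two words $u,v\in A^*$ is defined recursively by $\binom{u}{\varepsilon}_q=1$, $\binom{\varepsilon}{v}_q=0$ if $v\neq\varepsilon$, and, for all $u,v\in A^*$ and letters $a,b\in A$, $\binom{ua}{vb}_q=q^{|vb|}\binom{u}{vb}_q+\delta_{a,b}\binom{u}{v}_q$, where $\delta_{a,b}$ is the Kronecker delta. -}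

module Defs where

open import Data.Bool.Base using (if_then_else_)
open import Data.Fin.Base using (Fin; suc; toℕ)
open import Data.List.Base using (List; []; _∷_; [_]; _++_; _∷ʳ_; map; foldr; length; reverse; concatMap; inits; tails; filter; deduplicate; cartesianProductWith)
open import Data.List.Properties using (≡-dec; length-reverse; reverse-++; ++-assoc; ++-identityʳ)
open import Data.List.Membership.Propositional using (_∈_)
open import Data.List.Membership.Propositional.Properties using (∈-map⁺; ∈-concat⁺′; ∈-filter⁺; ∈-filter⁻; ∈-cartesianProductWith⁺; ∈-deduplicate⁺)
open import Data.List.Relation.Unary.Any using (here; there)
open import Data.List.Relation.Unary.All using ([])
open import Data.List.Relation.Unary.AllPairs using ([]; _∷_)
open import Data.List.Relation.Unary.Unique.Propositional using (Unique)
open import Data.List.Relation.Unary.Unique.Propositional.Properties using (filter⁺; cartesianProductWith⁺)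
open import Data.List.Relation.Unary.Unique.DecPropositional.Properties using (deduplicate-!)
open import Data.Nat.Base using (ℕ; zero; suc; _+_; _*_)
open import Data.Product.Base using (_×_; _,_; proj₂; ∃₂)
open import Data.Vec.Base as Vec using (Vec; []; _∷_)
import Data.Vec.Properties as Vec
open import Data.Vec.Relation.Unary.All as VecAll using ([]; _∷_)
open import Function.Bundles using (_⇔_; mk⇔)
open import Level using (Level)
open import Relation.Binary.Definitions using (DecidableEquality)
open import Relation.Binary.PropositionalEquality using (_≡_; refl; sym; trans; cong)
open import Relation.Nullary.Decidable.Core using (does)

private
  variable
    ℓ : Level
    A : Set ℓ
    k : ℕ

-- A polynomial is its list of coefficients, constant term first.  Trailing
-- zeros are allowed, so equality of polynomials is _≈_ and not _≡_.

ℕ[q] : Set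
ℕ[q] = List ℕ

coeff : ℕ[q] → ℕ → ℕ
coeff []      _       = 0
coeff (c ∷ p) zero    = c
coeff (c ∷ p) (suc n) = coeff p n

infix 4 _≈_
_≈_ : ℕ[q] → ℕ[q] → Set
p ≈ r = ∀ n → coeff p n ≡ coeff r n

0ₚ 1ₚ q : ℕ[q]
0ₚ = []
1ₚ = 1 ∷ []
q  = 0 ∷ 1 ∷ []

infixl 6 _+ₚ_
_+ₚ_ : ℕ[q] → ℕ[q] → ℕ[q]
[]      +ₚ r       = r
(c ∷ p) +ₚ []      = c ∷ p
(c ∷ p) +ₚ (d ∷ r) = c + d ∷ p +ₚ r

-- (c + q p) r = c r + q (p r)
infixl 7 _*ₚ_
_*ₚ_ : ℕ[q] → ℕ[q] → ℕ[q]
[]      *ₚ r = 0ₚ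
(c ∷ p) *ₚ r = map (c *_) r +ₚ (0 ∷ p *ₚ r)

infix 8 q^_
q^_ : ℕ → ℕ[q]
q^ zero  = 1ₚ
q^ suc n = q *ₚ q^ n

-- Sum over a list, which should have no repetitions when it stands for a set.
∑ : List A → (A → ℕ[q]) → ℕ[q]
∑ xs f = foldr _+ₚ_ 0ₚ (map f xs)

infix 5 ∑
syntax ∑ xs (λ x → p) = ∑[ x ∈ xs ] p

δ : DecidableEquality A → A → A → ℕ[q]
δ _≟_ a b = if does (a ≟ b) then 1ₚ else 0ₚ

-- The defining recursion of the q-binomial coefficient removes last letters,
-- so it is structural on reversed words; binom-ε, ε-binom and binom-∷ʳ below
-- are the recursion in its original form.

binomʳ : DecidableEquality A → List A → List A → ℕ[q]
binomʳ _≟_ u       []      = 1ₚ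
binomʳ _≟_ []      (b ∷ v) = 0ₚ
binomʳ _≟_ (a ∷ u) (b ∷ v) =
  q^ length (b ∷ v) *ₚ binomʳ _≟_ u (b ∷ v) +ₚ δ _≟_ a b *ₚ binomʳ _≟_ u v

binom : DecidableEquality A → List A → List A → ℕ[q]
binom _≟_ u v = binomʳ _≟_ (reverse u) (reverse v)

binom-ε : (_≟_ : DecidableEquality A) (u : List A) → binom _≟_ u [] ≡ 1ₚ
binom-ε _≟_ u with reverse u
... | []    = refl
... | _ ∷ _ = refl

ε-binom : (_≟_ : DecidableEquality A) (v : List A) (b : A) →
          binom _≟_ [] (v ∷ʳ b) ≡ 0ₚ
ε-binom _≟_ v b rewrite reverse-++ v [ b ] = refl

binom-∷ʳ : (_≟_ : DecidableEquality A) (u v : List A) (a b : A) →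
           binom _≟_ (u ∷ʳ a) (v ∷ʳ b) ≡
           q^ length (v ∷ʳ b) *ₚ binom _≟_ u (v ∷ʳ b) +ₚ δ _≟_ a b *ₚ binom _≟_ u v
binom-∷ʳ _≟_ u v a b
  rewrite sym (length-reverse (v ∷ʳ b)) | reverse-++ u [ a ] | reverse-++ v [ b ] = refl

-- interleave (u₀ , … , u_k) (a₁ , … , a_k) = u₀ a₁ u₁ ⋯ u_{k-1} a_k u_k
interleave : Vec (List A) (suc k) → Vec A k → List A
interleave (u₀ ∷ []) []       = u₀
interleave (u₀ ∷ us) (a ∷ as) = u₀ ++ a ∷ interleave us as

-- ∑ᵢ₌₁ᵏ i |uᵢ|; the index i : Fin k stands for i + 1, hence the shifts.
weight : Vec (List A) (suc k) → ℕ
weight us = Vec.sum (Vec.tabulate λ i → suc (toℕ i) * length (Vec.lookup us (suc i)))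

factors : DecidableEquality A → List A → List (List A)
factors _≟_ u = deduplicate (≡-dec _≟_) (concatMap inits (tails u))

tuples : ∀ n → List A → List (Vec A n)
tuples zero    xs = [ [] ]
tuples (suc n) xs = cartesianProductWith _∷_ xs (tuples n xs)

-- The set of all (u₀ , … , u_k) with u = u₀ a₁ u₁ ⋯ a_k u_k, as a list without
-- repetitions.  Drawing the uᵢ from the factors of u only serves finiteness:
-- ∈-decompositions ranges over arbitrary tuples of words.
decompositions : DecidableEquality A → List A → Vec A k → List (Vec (List A) (suc k))
decompositions _≟_ u as =
  filter (λ us → ≡-dec _≟_ u (interleave us as)) (tuples _ (factors _≟_ u))

private
  ∈-inits : (y z : List A) → y ∈ inits (y ++ z)
  ∈-inits []      z = here refl
  ∈-inits (c ∷ y) z = there (∈-map⁺ (c ∷_) (∈-inits y z))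

  ∈-tails : (x w : List A) → w ∈ tails (x ++ w)
  ∈-tails []      []      = here refl
  ∈-tails []      (_ ∷ _) = here refl
  ∈-tails (_ ∷ x) w       = there (∈-tails x w)

  ∈-factors : (_≟_ : DecidableEquality A) {u : List A} (x y z : List A) →
              u ≡ x ++ y ++ z → y ∈ factors _≟_ u
  ∈-factors _≟_ x y z refl = ∈-deduplicate⁺ (≡-dec _≟_)
    (∈-concat⁺′ (∈-inits y z) (∈-map⁺ inits (∈-tails x (y ++ z))))

  IsFactor : List A → List A → Set _
  IsFactor u y = ∃₂ λ x z → u ≡ x ++ y ++ z

  parts : (us : Vec (List A) (suc k)) (as : Vec A k) (u x : List A) →
          u ≡ x ++ interleave us as → VecAll.All (IsFactor u) us
  parts (u₀ ∷ []) [] u x eq = (x , [] , trans eq (cong (x ++_) (sym (++-identityʳ u₀)))) ∷ []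
  parts (u₀ ∷ us@(_ ∷ _)) (a ∷ as) u x eq =
    (x , a ∷ interleave us as , eq) ∷
    parts us as u (x ++ u₀ ++ [ a ]) (trans eq (trans
      (cong (x ++_) (sym (++-assoc u₀ [ a ] _)))
      (sym (++-assoc x (u₀ ++ [ a ]) _))))

  ∈-tuples : ∀ {n} {xs : List A} {v : Vec A n} → VecAll.All (_∈ xs) v → v ∈ tuples n xs
  ∈-tuples []       = here refl
  ∈-tuples (p ∷ ps) = ∈-cartesianProductWith⁺ _∷_ p (∈-tuples ps)

  tuples-unique : ∀ n {xs : List A} → Unique xs → Unique (tuples n xs)
  tuples-unique zero    _  = [] ∷ []
  tuples-unique (suc n) xs! =
    cartesianProductWith⁺ _∷_ Vec.∷-injective xs! (tuples-unique n xs!)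

∈-decompositions : (_≟_ : DecidableEquality A) (u : List A) (as : Vec A k)
                   (us : Vec (List A) (suc k)) →
                   us ∈ decompositions _≟_ u as ⇔ u ≡ interleave us as
∈-decompositions _≟_ u as us = mk⇔
  (λ p → proj₂ (∈-filter⁻ P? {xs = tuples _ (factors _≟_ u)} p))
  (λ eq → ∈-filter⁺ P?
    (∈-tuples (VecAll.map (λ { (x , z , e) → ∈-factors _≟_ x _ z e }) (parts us as u [] eq))) eq)
  where P? = λ us → ≡-dec _≟_ u (interleave us as)

decompositions-unique : (_≟_ : DecidableEquality A) (u : List A) (as : Vec A k) →
                        Unique (decompositions _≟_ u as)
decompositions-unique _≟_ u as =
  filter⁺ (λ us → ≡-dec _≟_ u (interleave us as))
    (tuples-unique _ (deduplicate-! (≡-dec _≟_) (concatMap inits (tails u))))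

{-# OPTIONS --safe #-}
-- Splitting off the last letter a of u: either u_k is non-empty and ends in a,
-- and deleting a lowers the exponent by k, or u_k is empty and a = a_k.  These
-- two cases are the two terms of the defining recursion.  The recursion runs on
-- reversed words, so it is solved for reversed tuples, which are then turned
-- around.
module Submission where

open import Defs
open import Data.Bool.Base using (if_then_else_)
open import Data.Fin.Base using (Fin; suc; toℕ)
open import Data.Fin.Properties using (inj⇒≟)
open import Data.List.Base using (List; []; _∷_; [_]; _++_; map; length; reverse)
open import Data.List.Membership.Propositional using (_∈_)
open import Data.List.Membership.Propositional.Properties using (∈-map⁺; ∈-map⁻; ∈-++⁺ˡ; ∈-++⁺ʳ; ∈-++⁻)
open import Data.List.Membership.Propositional.Properties.WithK using (unique∧set⇒bag)
open import Data.List.Properties as List using (map-∘; map-cong; map-id)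
open import Data.List.Relation.Binary.BagAndSetEquality using (∼bag⇒↭)
open import Data.List.Relation.Binary.Permutation.Propositional using (_↭_)
import Data.List.Relation.Binary.Permutation.Propositional.Properties as Perm
open import Data.List.Relation.Unary.All using ([])
open import Data.List.Relation.Unary.AllPairs using ([]; _∷_)
open import Data.List.Relation.Unary.Any using (here)
open import Data.List.Relation.Unary.Unique.Propositional using (Unique)
import Data.List.Relation.Unary.Unique.Propositional.Properties as Unique
open import Data.Nat.Base using (ℕ; zero; suc; _+_; _*_)
open import Data.Nat.ListAction using (sum)
open import Data.Nat.ListAction.Properties using (sum-↭)
open import Data.Nat.Properties using (+-assoc; +-comm; +-identityʳ; +-suc; *-identityˡ; *-zeroʳ; *-suc; *-distribˡ-+; +-0-commutativeMonoid)
open import Data.Product.Base using (_×_; _,_)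
open import Data.Sum.Base using (inj₁; inj₂)
open import Data.Vec.Base as Vec using (Vec; []; _∷_; toList)
import Data.Vec.Properties as Vec
open import Function.Base using (_∘_)
open import Function.Bundles using (_↔_; mk⇔; Equivalence)
open import Function.Properties.Inverse using (↔⇒↣)
open import Level using (Level)
open import Relation.Binary.Definitions using (DecidableEquality)
open import Relation.Binary.PropositionalEquality using (_≡_; refl; sym; trans; cong; cong₂; module ≡-Reasoning)
open import Relation.Nullary.Decidable.Core using (does; yes; no)
open import Relation.Nullary.Negation.Core using (contradiction)
open import Algebra.Bundles using (CommutativeMonoid)
open import Algebra.Properties.CommutativeSemigroup
  (CommutativeMonoid.commutativeSemigroup +-0-commutativeMonoid) using (interchange)

open ≡-Reasoning

private
  variable
    ℓ ℓ′ : Level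
    A : Set ℓ
    B : Set ℓ′
    k : ℕ

-- Arithmetic of polynomials, coefficient by coefficient

coeff-+ₚ : ∀ p r n → coeff (p +ₚ r) n ≡ coeff p n + coeff r n
coeff-+ₚ []      r       n       = refl
coeff-+ₚ (c ∷ p) []      n       = sym (+-identityʳ _)
coeff-+ₚ (c ∷ p) (d ∷ r) zero    = refl
coeff-+ₚ (c ∷ p) (d ∷ r) (suc n) = coeff-+ₚ p r n

coeff-map-* : ∀ c r n → coeff (map (c *_) r) n ≡ c * coeff r n
coeff-map-* c []      n       = sym (*-zeroʳ c)
coeff-map-* c (d ∷ r) zero    = refl
coeff-map-* c (d ∷ r) (suc n) = coeff-map-* c r n

coeff-∷-*ₚ : ∀ c p r n →
             coeff ((c ∷ p) *ₚ r) n ≡ c * coeff r n + coeff (0 ∷ p *ₚ r) n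
coeff-∷-*ₚ c p r n = trans (coeff-+ₚ (map (c *_) r) _ n)
  (cong (_+ coeff (0 ∷ p *ₚ r) n) (coeff-map-* c r n))

∷-cong : ∀ {p r} c → p ≈ r → c ∷ p ≈ c ∷ r
∷-cong c p≈r zero    = refl
∷-cong c p≈r (suc n) = p≈r n

+ₚ-cong : ∀ p p′ r r′ → p ≈ p′ → r ≈ r′ → p +ₚ r ≈ p′ +ₚ r′
+ₚ-cong p p′ r r′ p≈p′ r≈r′ n = begin
  coeff (p +ₚ r) n        ≡⟨ coeff-+ₚ p r n ⟩
  coeff p n + coeff r n   ≡⟨ cong₂ _+_ (p≈p′ n) (r≈r′ n) ⟩
  coeff p′ n + coeff r′ n ≡⟨ coeff-+ₚ p′ r′ n ⟨
  coeff (p′ +ₚ r′) n      ∎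

*ₚ-congˡ : ∀ p {r s} → r ≈ s → p *ₚ r ≈ p *ₚ s
*ₚ-congˡ []      r≈s n = refl
*ₚ-congˡ (c ∷ p) {r} {s} r≈s n = begin
  coeff ((c ∷ p) *ₚ r) n                ≡⟨ coeff-∷-*ₚ c p r n ⟩
  c * coeff r n + coeff (0 ∷ p *ₚ r) n  ≡⟨ cong₂ _+_ (cong (c *_) (r≈s n)) (∷-cong 0 (*ₚ-congˡ p r≈s) n) ⟩
  c * coeff s n + coeff (0 ∷ p *ₚ s) n  ≡⟨ coeff-∷-*ₚ c p s n ⟨
  coeff ((c ∷ p) *ₚ s) n                ∎

*ₚ-zeroʳ : ∀ p → p *ₚ 0ₚ ≈ 0ₚ
*ₚ-zeroʳ []      n       = refl
*ₚ-zeroʳ (c ∷ p) zero    = refl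
*ₚ-zeroʳ (c ∷ p) (suc n) = *ₚ-zeroʳ p n

*ₚ-distribˡ-+ₚ : ∀ p r s → p *ₚ (r +ₚ s) ≈ p *ₚ r +ₚ p *ₚ s
*ₚ-distribˡ-+ₚ []      r s n = refl
*ₚ-distribˡ-+ₚ (c ∷ p) r s n = begin
  coeff ((c ∷ p) *ₚ (r +ₚ s)) n
    ≡⟨ coeff-∷-*ₚ c p (r +ₚ s) n ⟩
  c * coeff (r +ₚ s) n + coeff (0 ∷ p *ₚ (r +ₚ s)) n
    -- The shift is additive by computation: `(0 ∷ x) +ₚ (0 ∷ y)` reduces to `0 ∷ x +ₚ y`.
    ≡⟨ cong₂ _+_ (cong (c *_) (coeff-+ₚ r s n)) (∷-cong 0 (*ₚ-distribˡ-+ₚ p r s) n) ⟩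
  c * (coeff r n + coeff s n) + coeff ((0 ∷ p *ₚ r) +ₚ (0 ∷ p *ₚ s)) n
    ≡⟨ cong₂ _+_ (*-distribˡ-+ c (coeff r n) (coeff s n)) (coeff-+ₚ (0 ∷ p *ₚ r) (0 ∷ p *ₚ s) n) ⟩
  (c * coeff r n + c * coeff s n) + (coeff (0 ∷ p *ₚ r) n + coeff (0 ∷ p *ₚ s) n)
    ≡⟨ interchange (c * coeff r n) _ _ _ ⟩
  (c * coeff r n + coeff (0 ∷ p *ₚ r) n) + (c * coeff s n + coeff (0 ∷ p *ₚ s) n)
    ≡⟨ cong₂ _+_ (coeff-∷-*ₚ c p r n) (coeff-∷-*ₚ c p s n) ⟨
  coeff ((c ∷ p) *ₚ r) n + coeff ((c ∷ p) *ₚ s) n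
    ≡⟨ coeff-+ₚ ((c ∷ p) *ₚ r) ((c ∷ p) *ₚ s) n ⟨
  coeff ((c ∷ p) *ₚ r +ₚ (c ∷ p) *ₚ s) n ∎

*ₚ-identityˡ : ∀ p → 1ₚ *ₚ p ≈ p
*ₚ-identityˡ p n = begin
  coeff (1ₚ *ₚ p) n                 ≡⟨ coeff-∷-*ₚ 1 [] p n ⟩
  1 * coeff p n + coeff (0 ∷ []) n  ≡⟨ cong₂ _+_ (*-identityˡ _) (0∷0ₚ n) ⟩
  coeff p n + 0                     ≡⟨ +-identityʳ _ ⟩
  coeff p n                         ∎
  where
  0∷0ₚ : 0 ∷ 0ₚ ≈ 0ₚ
  0∷0ₚ zero    = refl
  0∷0ₚ (suc n) = refl

-- On lists q *ₚ [] is 0 ∷ 0 ∷ [] and not 0 ∷ [], hence the non-empty argument.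
q*ₚ-∷ : ∀ c p → q *ₚ (c ∷ p) ≡ 0 ∷ c ∷ p
q*ₚ-∷ c p = cong (0 ∷_) (begin
  map (0 *_) p +ₚ (map (1 *_) (c ∷ p) +ₚ (0 ∷ []))
    ≡⟨ cong (λ r → map (0 *_) p +ₚ (r +ₚ (0 ∷ []))) (trans (map-cong *-identityˡ (c ∷ p)) (map-id (c ∷ p))) ⟩
  map (0 *_) p +ₚ (c + 0 ∷ p +ₚ [])
    ≡⟨ cong (map (0 *_) p +ₚ_) (cong₂ _∷_ (+-identityʳ c) (+ₚ-identityʳ p)) ⟩
  map (0 *_) p +ₚ (c ∷ p)
    ≡⟨ zeros-+ₚ c p ⟩
  c ∷ p ∎)
  where
  +ₚ-identityʳ : ∀ p → p +ₚ [] ≡ p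
  +ₚ-identityʳ []      = refl
  +ₚ-identityʳ (_ ∷ _) = refl

  zeros-+ₚ : ∀ c p → map (0 *_) p +ₚ (c ∷ p) ≡ c ∷ p
  zeros-+ₚ c []      = refl
  zeros-+ₚ c (d ∷ p) = cong (c ∷_) (zeros-+ₚ d p)

-- By induction `q^ m` is never the empty list, so `q*ₚ-∷` applies. The equality is one of lists and
-- can therefore be used for rewriting.
q^-suc : ∀ m → q^ suc m ≡ 0 ∷ q^ m
q^-suc zero    = refl
q^-suc (suc m) rewrite q^-suc m = q*ₚ-∷ 0 (q^ m)

q^-+ : ∀ m n → q^ m *ₚ q^ n ≈ q^ (m + n)
q^-+ zero    n i = *ₚ-identityˡ (q^ n) i
-- Once `q^ suc m` reads `0 ∷ q^ m`, its constant term contributes `0 * coeff (q^ n) i`, which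
-- vanishes by computation; what remains is the shifted induction hypothesis.
q^-+ (suc m) n i rewrite q^-suc m | q^-suc (m + n) =
  trans (coeff-∷-*ₚ 0 (q^ m) (q^ n) i) (∷-cong 0 (q^-+ m n) i)

-- Finite sums of polynomials

∑-cong : ∀ (xs : List A) (f g : A → ℕ[q]) → (∀ x → f x ≈ g x) → ∑ xs f ≈ ∑ xs g
∑-cong []       f g f≈g n = refl
∑-cong (x ∷ xs) f g f≈g = +ₚ-cong (f x) (g x) (∑ xs f) (∑ xs g) (f≈g x) (∑-cong xs f g f≈g)

∑-map : ∀ (g : A → B) xs {f} → ∑ (map g xs) f ≡ ∑ xs (f ∘ g)
∑-map g []           = refl
∑-map g (x ∷ xs) {f} = cong (f (g x) +ₚ_) (∑-map g xs)

coeff-∑ : ∀ (xs : List A) f n → coeff (∑ xs f) n ≡ sum (map (λ x → coeff (f x) n) xs)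
coeff-∑ []       f n = refl
coeff-∑ (x ∷ xs) f n = trans (coeff-+ₚ (f x) (∑ xs f) n)
  (cong (coeff (f x) n +_) (coeff-∑ xs f n))

∑-++ : ∀ (xs ys : List A) f → ∑ (xs ++ ys) f ≈ ∑ xs f +ₚ ∑ ys f
∑-++ []       ys f n = refl
∑-++ (x ∷ xs) ys f n = begin
  coeff (f x +ₚ ∑ (xs ++ ys) f) n                     ≡⟨ coeff-+ₚ (f x) _ n ⟩
  coeff (f x) n + coeff (∑ (xs ++ ys) f) n            ≡⟨ cong (coeff (f x) n +_) (trans (∑-++ xs ys f n) (coeff-+ₚ (∑ xs f) _ n)) ⟩
  coeff (f x) n + (coeff (∑ xs f) n + coeff (∑ ys f) n) ≡⟨ +-assoc (coeff (f x) n) _ _ ⟨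
  coeff (f x) n + coeff (∑ xs f) n + coeff (∑ ys f) n ≡⟨ cong (_+ coeff (∑ ys f) n) (coeff-+ₚ (f x) (∑ xs f) n) ⟨
  coeff (f x +ₚ ∑ xs f) n + coeff (∑ ys f) n          ≡⟨ coeff-+ₚ (f x +ₚ ∑ xs f) _ n ⟨
  coeff (∑ (x ∷ xs) f +ₚ ∑ ys f) n                    ∎

-- Each coefficient of a sum is a sum of natural numbers, and those may be permuted.
∑-↭ : {xs ys : List A} (f : A → ℕ[q]) → xs ↭ ys → ∑ xs f ≈ ∑ ys f
∑-↭ {xs = xs} {ys} f xs↭ys n = begin
  coeff (∑ xs f) n                    ≡⟨ coeff-∑ xs f n ⟩
  sum (map (λ x → coeff (f x) n) xs)  ≡⟨ sum-↭ (Perm.map⁺ _ xs↭ys) ⟩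
  sum (map (λ x → coeff (f x) n) ys)  ≡⟨ coeff-∑ ys f n ⟨
  coeff (∑ ys f) n                    ∎

*ₚ-distribˡ-∑ : ∀ p (xs : List A) f → p *ₚ ∑ xs f ≈ ∑[ x ∈ xs ] p *ₚ f x
*ₚ-distribˡ-∑ p []       f   = *ₚ-zeroʳ p
*ₚ-distribˡ-∑ p (x ∷ xs) f n = trans (*ₚ-distribˡ-+ₚ p (f x) (∑ xs f) n)
  (+ₚ-cong (p *ₚ f x) (p *ₚ f x) (p *ₚ ∑ xs f) _ (λ _ → refl) (*ₚ-distribˡ-∑ p xs f) n)

-- Solving the recursion on reversed words

-- The exponent of a reversed tuple (u_k , … , u₀).
weightʳ : Vec (List A) k → ℕ
weightʳ               []       = 0
weightʳ {k = suc k} (w ∷ ws) = k * length w + weightʳ ws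

-- The head of a reversed tuple is `u_k` read backwards, so this gives `u_k` a new last letter.
consHead : A → Vec (List A) (suc k) → Vec (List A) (suc k)
consHead a (w ∷ ws) = (a ∷ w) ∷ ws

consHead-injective : (a : A) {us vs : Vec (List A) (suc k)} →
                     consHead a us ≡ consHead a vs → us ≡ vs
consHead-injective a {_ ∷ _} {_ ∷ _} refl = refl

-- The head of a tuple of `suc k` words carries the factor `k`, so one more letter there costs
-- exactly `k`.
weightʳ-consHead : (a : A) (us : Vec (List A) (suc k)) →
                   weightʳ (consHead a us) ≡ k + weightʳ us
weightʳ-consHead {k = k} a (w ∷ ws) =
  trans (cong (_+ weightʳ ws) (*-suc k (length w))) (+-assoc k _ _)

module _ {A : Set ℓ} (_≟_ : DecidableEquality A) where

  -- Modelled on the clauses of `binomʳ`: the two halves of the concatenation correspond to the two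
  -- terms of the recursion.
  splittings : List A → Vec A k → List (Vec (List A) (suc k))
  splittings u       []       = [ u ∷ [] ]
  splittings []      (b ∷ bs) = []
  splittings (a ∷ u) (b ∷ bs) =
    map (consHead a) (splittings u (b ∷ bs)) ++
    (if does (a ≟ b) then map ([] ∷_) (splittings u bs) else [])

  ∈-splittings⁻ : (u : List A) (bs : Vec A k) {us : Vec (List A) (suc k)} →
                  us ∈ splittings u bs → u ≡ interleave us bs
  ∈-splittings⁻ u       []       (here refl) = refl
  ∈-splittings⁻ (a ∷ u) (b ∷ bs) us∈
    with ∈-++⁻ (map (consHead a) (splittings u (b ∷ bs))) us∈
  ... | inj₁ us∈ˡ with ∈-map⁻ (consHead a) us∈ˡ
  -- The second word is exposed so that `interleave` reduces.
  ...   | (_ ∷ _ ∷ _) , vs∈ , refl = cong (a ∷_) (∈-splittings⁻ u (b ∷ bs) vs∈)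
  ∈-splittings⁻ (a ∷ u) (b ∷ bs) us∈ | inj₂ us∈ʳ with a ≟ b
  ... | yes refl with ∈-map⁻ ([] ∷_) us∈ʳ
  ...   | (_ ∷ _) , vs∈ , refl = cong (a ∷_) (∈-splittings⁻ u bs vs∈)

  -- The head decides the branch: if it is empty, the word starts with the matched letter `b`;
  -- otherwise its first letter can be removed by undoing `consHead`.
  ∈-splittings⁺ : (us : Vec (List A) (suc k)) (bs : Vec A k) →
                  us ∈ splittings (interleave us bs) bs
  ∈-splittings⁺ (u ∷ [])       []       = here refl
  ∈-splittings⁺ ([] ∷ us@(_ ∷ _)) (b ∷ bs)
    with b ≟ b
  ... | yes _  = ∈-++⁺ʳ (map (consHead b) (splittings (interleave us bs) (b ∷ bs)))
                   (∈-map⁺ ([] ∷_) (∈-splittings⁺ us bs))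
  ... | no b≢b = contradiction refl b≢b
  ∈-splittings⁺ ((a ∷ w) ∷ us@(_ ∷ _)) (b ∷ bs) =
    ∈-++⁺ˡ (∈-map⁺ (consHead a) (∈-splittings⁺ (w ∷ us) (b ∷ bs)))

  -- The two halves are disjoint because the head is non-empty in the first and empty in the second.
  splittings-unique : (u : List A) (bs : Vec A k) → Unique (splittings u bs)
  splittings-unique u       []       = [] ∷ []
  splittings-unique []      (b ∷ bs) = []
  splittings-unique (a ∷ u) (b ∷ bs) with a ≟ b
  ... | no _  = Unique.++⁺ (Unique.map⁺ (consHead-injective a) (splittings-unique u (b ∷ bs))) []
                  λ { (_ , ()) }
  ... | yes _ = Unique.++⁺ (Unique.map⁺ (consHead-injective a) (splittings-unique u (b ∷ bs)))
                  (Unique.map⁺ Vec.∷-injectiveʳ (splittings-unique u bs)) disjoint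
    where
    disjoint : ∀ {vs} → vs ∈ map (consHead a) (splittings u (b ∷ bs)) ×
                        vs ∈ map ([] ∷_) (splittings u bs) → _
    disjoint (p , r) with ∈-map⁻ (consHead a) p | ∈-map⁻ ([] ∷_) r
    ... | (_ ∷ _) , _ , refl | _ , _ , ()

  -- Induction on `u`: `lengthen` handles the term with the power of `q`, `match` the term with the
  -- Kronecker delta.
  binomʳ-∑ : (u : List A) (bs : Vec A k) →
             binomʳ _≟_ u (toList bs) ≈ ∑[ us ∈ splittings u bs ] q^ weightʳ us
  binomʳ-∑ []      []       n = refl
  binomʳ-∑ (_ ∷ _) []       n = refl
  binomʳ-∑ []      (b ∷ bs) n = refl
  binomʳ-∑ {k = suc k} (a ∷ u) (b ∷ bs) n = begin
    coeff (q^ length (toList (b ∷ bs)) *ₚ binomʳ _≟_ u (toList (b ∷ bs)) +ₚ δ _≟_ a b *ₚ binomʳ _≟_ u (toList bs)) n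
      ≡⟨ +ₚ-cong (q^ length (toList (b ∷ bs)) *ₚ binomʳ _≟_ u (toList (b ∷ bs))) (∑ longer f) _ _ lengthen match n ⟩
    coeff (∑ longer f +ₚ ∑ matched f) n
      ≡⟨ ∑-++ longer matched f n ⟨
    coeff (∑ (longer ++ matched) f) n ∎
    where
    f : ∀ {k} → Vec (List A) k → ℕ[q]
    f us = q^ weightʳ us

    longer matched : List (Vec (List A) (suc (suc k)))
    longer  = map (consHead a) (splittings u (b ∷ bs))
    matched = if does (a ≟ b) then map ([] ∷_) (splittings u bs) else []

    lengthen : q^ length (toList (b ∷ bs)) *ₚ binomʳ _≟_ u (toList (b ∷ bs)) ≈ ∑ longer f
    lengthen n
      -- The power in the recursion becomes `q^ suc k`, and `suc k` is also what a letter added to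
      -- the head costs by `weightʳ-consHead`.
      rewrite Vec.length-toList bs | ∑-map (consHead a) (splittings u (b ∷ bs)) {f} = begin
      coeff (q^ suc k *ₚ binomʳ _≟_ u (b ∷ toList bs)) n
        ≡⟨ *ₚ-congˡ (q^ suc k) (binomʳ-∑ u (b ∷ bs)) n ⟩
      coeff (q^ suc k *ₚ ∑ (splittings u (b ∷ bs)) f) n
        ≡⟨ *ₚ-distribˡ-∑ (q^ suc k) (splittings u (b ∷ bs)) f n ⟩
      coeff (∑[ us ∈ splittings u (b ∷ bs) ] q^ suc k *ₚ f us) n
        ≡⟨ ∑-cong (splittings u (b ∷ bs)) _ _ shift n ⟩
      coeff (∑[ us ∈ splittings u (b ∷ bs) ] f (consHead a us)) n ∎
      where
      shift : ∀ us → q^ suc k *ₚ f us ≈ f (consHead a us)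
      shift us rewrite weightʳ-consHead a us = q^-+ (suc k) (weightʳ us)

    match : δ _≟_ a b *ₚ binomʳ _≟_ u (toList bs) ≈ ∑ matched f
    match n with a ≟ b
    ... | no  _ = refl
    ... | yes _ rewrite ∑-map ([] ∷_) (splittings u bs) {f} = begin
      coeff (1ₚ *ₚ binomʳ _≟_ u (toList bs)) n          ≡⟨ *ₚ-identityˡ (binomʳ _≟_ u (toList bs)) n ⟩
      coeff (binomʳ _≟_ u (toList bs)) n                ≡⟨ binomʳ-∑ u bs n ⟩
      coeff (∑ (splittings u bs) f) n                   ≡⟨ ∑-cong (splittings u bs) _ _ empty n ⟩
      coeff (∑[ us ∈ splittings u bs ] f ([] ∷ us)) n   ∎
      where
      empty : ∀ (us : Vec (List A) (suc k)) → f us ≈ f ([] ∷ us)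
      -- An empty head adds `suc k * 0` to the exponent, which computes only as far as `k * 0`.
      empty us n rewrite *-zeroʳ k = refl

-- Turning tuples around

-- Reading `u₀ a₁ u₁ ⋯ a_k u_k` backwards reverses the order of the words and also each single word.
flip : Vec (List A) k → Vec (List A) k
flip us = Vec.reverse (Vec.map reverse us)

flip-∷ : (w : List A) (us : Vec (List A) k) → flip (w ∷ us) ≡ flip us Vec.∷ʳ reverse w
flip-∷ w us = Vec.reverse-∷ (reverse w) (Vec.map reverse us)

flip-involutive : (us : Vec (List A) k) → flip (flip us) ≡ us
flip-involutive us = begin
  Vec.reverse (Vec.map reverse (Vec.reverse (Vec.map reverse us)))  ≡⟨ cong Vec.reverse (Vec.map-reverse reverse (Vec.map reverse us)) ⟩
  Vec.reverse (Vec.reverse (Vec.map reverse (Vec.map reverse us)))  ≡⟨ Vec.reverse-involutive _ ⟩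
  Vec.map reverse (Vec.map reverse us)                              ≡⟨ Vec.map-∘ reverse reverse us ⟨
  Vec.map (reverse ∘ reverse) us                                    ≡⟨ Vec.map-cong List.reverse-involutive us ⟩
  Vec.map (λ w → w) us                                              ≡⟨ Vec.map-id us ⟩
  us                                                                ∎

interleave-∷ʳ : (us : Vec (List A) (suc k)) (as : Vec A k) (w : List A) (a : A) →
                interleave (us Vec.∷ʳ w) (as Vec.∷ʳ a) ≡ interleave us as ++ a ∷ w
interleave-∷ʳ (u ∷ [])         []       w a = refl
interleave-∷ʳ (u ∷ us@(_ ∷ _)) (b ∷ as) w a = begin
  u ++ b ∷ interleave (us Vec.∷ʳ w) (as Vec.∷ʳ a)  ≡⟨ cong (λ v → u ++ b ∷ v) (interleave-∷ʳ us as w a) ⟩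
  u ++ (b ∷ interleave us as) ++ a ∷ w             ≡⟨ List.++-assoc u _ _ ⟨
  (u ++ b ∷ interleave us as) ++ a ∷ w             ∎

-- Removing the prefix `u a` from a word removes the suffix `a ∷ reverse u` from its reverse;
-- `interleave-∷ʳ` describes that suffix in terms of tuples.
interleave-flip : (us : Vec (List A) (suc k)) (as : Vec A k) →
                  interleave (flip us) (Vec.reverse as) ≡ reverse (interleave us as)
interleave-flip (u ∷ [])         []       = refl
interleave-flip (u ∷ us@(_ ∷ _)) (a ∷ as) = begin
  interleave (flip (u ∷ us)) (Vec.reverse (a ∷ as))
    ≡⟨ cong₂ interleave (flip-∷ u us) (Vec.reverse-∷ a as) ⟩
  interleave (flip us Vec.∷ʳ reverse u) (Vec.reverse as Vec.∷ʳ a)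
    ≡⟨ interleave-∷ʳ (flip us) (Vec.reverse as) (reverse u) a ⟩
  interleave (flip us) (Vec.reverse as) ++ a ∷ reverse u
    ≡⟨ cong (_++ a ∷ reverse u) (interleave-flip us as) ⟩
  reverse (interleave us as) ++ a ∷ reverse u
    ≡⟨ List.++-assoc (reverse (interleave us as)) [ a ] (reverse u) ⟨
  (reverse (interleave us as) ++ [ a ]) ++ reverse u
    ≡⟨ cong (_++ reverse u) (List.unfold-reverse a (interleave us as)) ⟨
  reverse (a ∷ interleave us as) ++ reverse u
    ≡⟨ List.reverse-++ u (a ∷ interleave us as) ⟨
  reverse (u ++ a ∷ interleave us as) ∎

-- The starting index varies so that induction on the tuple can pass to a tail, which is indexed
-- from `suc m`.
weightFrom : ℕ → Vec (List A) k → ℕ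
weightFrom m []       = 0
weightFrom m (w ∷ ws) = m * length w + weightFrom (suc m) ws

sum-tabulate-weightFrom : ∀ m (us : Vec (List A) k) →
  Vec.sum (Vec.tabulate λ i → (m + toℕ i) * length (Vec.lookup us i)) ≡ weightFrom m us
sum-tabulate-weightFrom m []       = refl
sum-tabulate-weightFrom m (w ∷ ws) = cong₂ _+_ (cong (_* length w) (+-identityʳ m)) (trans
  (cong Vec.sum (Vec.tabulate-cong λ i → cong (_* length (Vec.lookup ws i)) (+-suc m (toℕ i))))
  (sum-tabulate-weightFrom (suc m) ws))

-- Starting from 0 gives `u₀` the factor 0, and `u₁` is then counted with factor 1 as in `weight`.
weight-weightFrom : (us : Vec (List A) (suc k)) → weight us ≡ weightFrom 0 us
weight-weightFrom (u ∷ us) = sum-tabulate-weightFrom 1 us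

weightFrom-∷ʳ : ∀ m (us : Vec (List A) k) w →
                weightFrom m (us Vec.∷ʳ w) ≡ weightFrom m us + (m + k) * length w
weightFrom-∷ʳ m []       w = trans (+-identityʳ _) (cong (_* length w) (sym (+-identityʳ m)))
weightFrom-∷ʳ {k = suc k} m (u ∷ us) w rewrite weightFrom-∷ʳ (suc m) us w | +-suc m k =
  sym (+-assoc (m * length u) _ _)

-- The head of a tuple of `suc k` words moves to the last place, whose index is `k`, the factor that
-- it has in `weightʳ`.
weightFrom-flip : (us : Vec (List A) k) → weightFrom 0 (flip us) ≡ weightʳ us
weightFrom-flip []                     = refl
weightFrom-flip {k = suc k} (w ∷ us) = begin
  weightFrom 0 (flip (w ∷ us))                       ≡⟨ cong (weightFrom 0) (flip-∷ w us) ⟩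
  weightFrom 0 (flip us Vec.∷ʳ reverse w)            ≡⟨ weightFrom-∷ʳ 0 (flip us) (reverse w) ⟩
  weightFrom 0 (flip us) + k * length (reverse w)    ≡⟨ cong₂ (λ m n → m + k * n) (weightFrom-flip us) (List.length-reverse w) ⟩
  weightʳ us + k * length w                          ≡⟨ +-comm (weightʳ us) _ ⟩
  k * length w + weightʳ us                          ∎

-- Comparison with the decompositions

-- Neither list has repetitions, so having the same members makes them permutations of each other.
splittings-↭ : (_≟_ : DecidableEquality A) (u : List A) (as : Vec A k) →
               map flip (splittings _≟_ (reverse u) (Vec.reverse as)) ↭ decompositions _≟_ u as
splittings-↭ _≟_ u as = ∼bag⇒↭ (unique∧set⇒bag
  (Unique.map⁺ flip-injective (splittings-unique _≟_ (reverse u) (Vec.reverse as)))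
  (decompositions-unique _≟_ u as)
  (mk⇔ to from))
  where
  flip-injective : ∀ {us vs} → flip us ≡ flip vs → us ≡ vs
  flip-injective {us} {vs} eq =
    trans (sym (flip-involutive us)) (trans (cong flip eq) (flip-involutive vs))

  to : ∀ {us} → us ∈ map flip (splittings _≟_ (reverse u) (Vec.reverse as)) →
       us ∈ decompositions _≟_ u as
  to us∈ with ∈-map⁻ flip us∈
  -- It suffices to compare the reverses of both words, since that is where `∈-splittings⁻` speaks
  -- about `vs`.
  ... | vs , vs∈ , refl = Equivalence.from (∈-decompositions _≟_ u as (flip vs)) (List.reverse-injective (begin
    reverse u                                       ≡⟨ ∈-splittings⁻ _≟_ (reverse u) (Vec.reverse as) vs∈ ⟩
    interleave vs (Vec.reverse as)                  ≡⟨ cong (λ ws → interleave ws (Vec.reverse as)) (flip-involutive vs) ⟨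
    interleave (flip (flip vs)) (Vec.reverse as)    ≡⟨ interleave-flip (flip vs) as ⟩
    reverse (interleave (flip vs) as)               ∎))

  from : ∀ {us} → us ∈ decompositions _≟_ u as →
         us ∈ map flip (splittings _≟_ (reverse u) (Vec.reverse as))
  from {us} us∈ with refl ← Equivalence.to (∈-decompositions _≟_ u as us) us∈
    -- The preimage of `us` is `flip us`: interleaved with the reversed letters it gives the reverse
    -- of the word, and flipping it again returns `us`.
    with us∈S ← ∈-map⁺ flip (∈-splittings⁺ _≟_ (flip us) (Vec.reverse as))
    rewrite interleave-flip us as | flip-involutive us = us∈S

binom-∑ : (_≟_ : DecidableEquality A) (u : List A) (as : Vec A k) →
          binom _≟_ u (toList as) ≈ ∑[ us ∈ decompositions _≟_ u as ] q^ weight us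
binom-∑ _≟_ u as n = begin
  coeff (binomʳ _≟_ (reverse u) (reverse (toList as))) n
    ≡⟨ cong (λ v → coeff (binomʳ _≟_ (reverse u) v) n) (Vec.toList-reverse as) ⟨
  coeff (binomʳ _≟_ (reverse u) (toList (Vec.reverse as))) n
    ≡⟨ binomʳ-∑ _≟_ (reverse u) (Vec.reverse as) n ⟩
  coeff (∑[ us ∈ S ] q^ weightʳ us) n
    -- The exponents are translated before reindexing by `flip`, as they agree tuple by tuple.
    ≡⟨ ∑-cong S _ _ (λ us n → cong (λ m → coeff (q^ m) n) (trans (weight-weightFrom (flip us)) (weightFrom-flip us))) n ⟨
  coeff (∑[ us ∈ S ] q^ weight (flip us)) n
    ≡⟨ cong (λ p → coeff p n) (∑-map flip S) ⟨
  coeff (∑[ us ∈ map flip S ] q^ weight us) n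
    ≡⟨ ∑-↭ (λ us → q^ weight us) (splittings-↭ _≟_ u as) n ⟩
  coeff (∑[ us ∈ decompositions _≟_ u as ] q^ weight us) n ∎
  where S = splittings _≟_ (reverse u) (Vec.reverse as)

theorem3p1 : {ℓ : Level} {A : Set ℓ} {n : ℕ} (finite : A ↔ Fin n) (u : List A) (k : ℕ) (as : Vec A k) →
    let _≟_ = inj⇒≟ (↔⇒↣ finite) in
    binom _≟_ u (toList as) ≈ ∑[ us ∈ decompositions _≟_ u as ] q^ weight us
-- The bijection with `Fin n` enters through the decidable equality of letters that it induces.
theorem3p1 finite u k as = binom-∑ (inj⇒≟ (↔⇒↣ finite)) u as
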